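{- Let $\mathbf{F}_q$ be a finite field with $q>2$ elements and characteristic $p$. For $D\subseteq\mathbf{F}_q$, $k\ge1$, $b\in\mathbf{F}_q$ let $N(k,b,D)$ be the number of $k$-element subsets of $D$ whose elements sum to $b$. Then for every integer $1\le k\le q-2$ and every $b\in\mathbf{F}_q$, $$N(k,b,\mathbf{F}_q\setminus\{0,1\})=\frac1q\binom{q-2}{k}+\frac1q(-1)^kR^2_k-(-1)^kS(k,k-b),$$ where $k-b$ denotes the element $k\cdot 1-b\in\mathbf{F}_q$, and $R^2_k$, $S(k,c)$ are as defined in the context.
   Context: For an integer $k\ge0$, $\langle k\rangle_p$ denotes the least non-negative residue of $k$ modulo $p$ and $\lfloor x\rfloor$ the largest integer $\le x$. Binomial coefficients are $\binom{x}{m}=x(x-1)\cdots(x-m+1)/m!$ for real $x$ and integer $m\ge0$ (so e.g. $\binom{ -1}{m}=(-1)^m$). Define $$R^2_k=-p(-1)^{\lfloor k/p\rfloor}\binom{q/p-2}{\lfloor k/p\rfloor}+(p-1-\langle k\rangle_p)(-1)^{\lfloor k/p\rfloor}\binom{q/p-1}{\lfloor k/p\rfloor}.$$ For $c\in\mathbf{F}_q$: if $c$ lies in the prime field $\mathbf{F}_p$, identify $c$ with an integer and let $\langle c\rangle_p\in\{0,\dots,p-1\}$ be its residue, set $\delta_{c,k}=1$ if $\langle c\rangle_p>\langle k\rangle_p$ and $\delta_{c,k}=0$ otherwise, and define $$S(k,c)=-(-1)^{\lfloor k/p\rfloor}\binom{q/p-2}{\lfloor k/p\rfloor}+\delta_{c,k}(-1)^{\lfloor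 k/p\rfloor}\binom{q/p-1}{\lfloor k/p\rfloor};$$ if $c\notin\mathbf{F}_p$, define $S(k,c)=0$. -}

module Defs where

open import Data.Nat as ℕ using (ℕ; zero; suc; _<_; _∸_)
open import Data.Nat.DivMod as DM using ()
open import Data.Nat.Primality using (Prime; prime⇒nonZero)
open import Data.Integer as ℤ using (ℤ; +_)
open import Data.Rational as ℚ using (ℚ; 0ℚ; 1ℚ; _/_)
open import Data.Fin as Fin using (Fin)
open import Data.Vec using (Vec; []; _∷_)
open import Data.Bool using (Bool; true; false; _∧_; not)
open import Data.List using (List; []; _∷_; [_]; map; _++_; filterᵇ; length)
open import Data.Maybe using (Maybe; just; nothing)
open import Data.Product using (Σ; _,_)
open import Relation.Binary.PropositionalEquality using (_≡_; _≢_)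
open import Relation.Nullary using (does)
open import Relation.Nullary.Decidable using (⌊_⌋)
open import Algebra.Structures using (IsCommutativeRing)

-- A finite field with q elements, represented (up to isomorphism) as a
-- field structure on the finite set Fin q with propositional equality.

record FiniteField (q : ℕ) : Set where
  field
    _+_ _*_ : Fin q → Fin q → Fin q
    -_      : Fin q → Fin q
    0# 1#   : Fin q
    isCommutativeRing : IsCommutativeRing _≡_ _+_ _*_ -_ 0# 1#
    0≢1     : 0# ≢ 1#
    inverse : ∀ x → x ≢ 0# → Σ (Fin q) (λ y → (x * y) ≡ 1#)

  natF : ℕ → Fin q
  natF zero    = 0#
  natF (suc m) = 1# + natF m

  -- sum of the elements of a subset of Fin q (subset given by its
  -- characteristic vector; f maps positions to the field elements)
  sumSub : ∀ {n} → Vec Bool n → (Fin n → Fin q) → Fin q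
  sumSub []            f = 0#
  sumSub (true  ∷ s)  f = f Fin.zero + sumSub s (λ i → f (Fin.suc i))
  sumSub (false ∷ s)  f = sumSub s (λ i → f (Fin.suc i))

open FiniteField public using (natF)

IsCharacteristic : ∀ {q} → FiniteField q → ℕ → Set
IsCharacteristic F p =
  (0 < p) Data.Product.× (natF F p ≡ FiniteField.0# F)
    Data.Product.× (∀ m → 0 < m → m < p → natF F m ≢ FiniteField.0# F)
  where open import Data.Product using (_×_)

allSubsets : (n : ℕ) → List (Vec Bool n)
allSubsets zero    = [ [] ]
allSubsets (suc n) = map (true ∷_) (allSubsets n) ++ map (false ∷_) (allSubsets n)

card : ∀ {n} → Vec Bool n → ℕ
card []          = 0
card (true ∷ s)  = suc (card s)
card (false ∷ s) = card s

within : ∀ {n} {A : Set} → (A → Bool) → Vec Bool n → (Fin n → A) → Bool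
within D []          f = true
within D (true ∷ s)  f = D (f Fin.zero) ∧ within D s (λ i → f (Fin.suc i))
within D (false ∷ s) f = within D s (λ i → f (Fin.suc i))

N : ∀ {q} → FiniteField q → (D : Fin q → Bool) → ℕ → Fin q → ℕ
N {q} F D k b = length (filterᵇ
  (λ s → ⌊ card s ℕ.≟ k ⌋ ∧ within D s (λ i → i)
          ∧ ⌊ FiniteField.sumSub F s (λ i → i) Fin.≟ b ⌋)
  (allSubsets q))

noZeroOne : ∀ {q} → FiniteField q → Fin q → Bool
noZeroOne F x = not ⌊ x Fin.≟ FiniteField.0# F ⌋ ∧ not ⌊ x Fin.≟ FiniteField.1# F ⌋

ℤ→ℚ : ℤ → ℚ
ℤ→ℚ z = z / 1

ℕ→ℚ : ℕ → ℚ
ℕ→ℚ n = (+ n) / 1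

binom : ℚ → ℕ → ℚ
binom x zero    = 1ℚ
binom x (suc m) = binom x m ℚ.* ((x ℚ.- ℕ→ℚ m) ℚ.* ((+ 1) / suc m))

-- x / n for a positive natural n (only used with n = q > 2)
_÷ℕ_ : ℚ → ℕ → ℚ
x ÷ℕ zero    = 0ℚ
x ÷ℕ (suc n) = x ℚ.* ((+ 1) / suc n)

sgn : ℕ → ℚ
sgn zero    = 1ℚ
sgn (suc m) = ℚ.- sgn m

divP : (p : ℕ) → Prime p → ℕ → ℕ
divP p pr k = DM._/_ k p {{prime⇒nonZero pr}}

modP : (p : ℕ) → Prime p → ℕ → ℕ
modP p pr k = DM._%_ k p {{prime⇒nonZero pr}}

qp : (q p : ℕ) → Prime p → ℚ
qp q p pr = _/_ (+ q) p {{prime⇒nonZero pr}}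

R2 : (q p : ℕ) → Prime p → ℕ → ℚ
R2 q p pr k =
  (ℚ.- (ℕ→ℚ p ℚ.* (sgn j ℚ.* binom (qp q p pr ℚ.- ℕ→ℚ 2) j)))
  ℚ.+ (ℕ→ℚ (p ∸ 1 ∸ modP p pr k) ℚ.* (sgn j ℚ.* binom (qp q p pr ℚ.- 1ℚ) j))
  where j = divP p pr k

-- ⟨c⟩_p: least m < p with m·1 = c, if c lies in the prime field
primeRepFrom : ∀ {q} → FiniteField q → (c : Fin q) → ℕ → (fuel : ℕ) → Maybe ℕ
primeRepFrom F c m zero = nothing
primeRepFrom F c m (suc fuel) with does (natF F m Fin.≟ c)
... | true  = just m
... | false = primeRepFrom F c (suc m) fuel

primeRep : ∀ {q} → FiniteField q → ℕ → Fin q → Maybe ℕ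
primeRep F p c = primeRepFrom F c 0 p

S : ∀ {q} → FiniteField q → (p : ℕ) → Prime p → ℕ → Fin q → ℚ
S {q} F p pr k c with primeRep F p c
... | nothing = 0ℚ
... | just r  =
  (ℚ.- (sgn j ℚ.* binom (qp q p pr ℚ.- ℕ→ℚ 2) j))
  ℚ.+ (δ ℚ.* (sgn j ℚ.* binom (qp q p pr ℚ.- 1ℚ) j))
  where
  j = divP p pr k
  δ = if ⌊ modP p pr k ℕ.<? r ⌋ then 1ℚ else 0ℚ
    where open import Data.Bool using (if_then_else_)

{-# OPTIONS --safe #-}

-- Write N₀, N₁, N₂ for the counting functions of F, F ∖ {0} and F ∖ {0, 1}, so that
--   N₀(k, b) = N₁(k, b) + N₁(k-1, b)   and   N₁(k, b) = N₂(k, b) + N₂(k-1, b-1).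
-- By scaling, N₁(k, b) is the same for all b ≠ 0; let Δₖ = N₁(k, 0) - N₁(k, 1).
-- If p ∤ k, translation shows that N₀(k, ·) is constant, so Δₖ = -Δₖ₋₁.
-- If p ∣ k, double counting gives k N₀(k, b) = q N₁(k-1, b), so Δₖ = (q/k - 1) Δₖ₋₁.
-- Hence Δₖ = (-1)^k Eⱼ with j = ⌊k/p⌋ and Eⱼ = (-1)^j binom(q/p - 1, j), and
--   q N₁(k, b) = binom(q-1, k) - Δₖ + q Δₖ [b = 0].
-- The formula for N₂ follows by induction on k from the second recursion: k - b is
-- unchanged when k and b both drop by 1, while R²ₖ - R²ₖ₋₁ = -Eⱼ and
-- S(k, c) - S(k-1, c) = -[c = k] Eⱼ.
module Submission where

open import Defs
open import Data.Nat using (ℕ; _≤_; _<_; _∸_)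
open import Data.Nat.Primality using (Prime)
open import Data.Nat.Combinatorics using (_C_)
open import Data.Fin using (Fin)
open import Data.Rational as ℚ using (ℚ; _+_; _-_; _*_)
open import Relation.Binary.PropositionalEquality using (_≡_)

open import Algebra.Bundles using (CommutativeRing)
import Algebra.Properties.AbelianGroup as AbelianGroupProperties
import Algebra.Properties.CommutativeSemigroup as CommutativeSemigroupProperties
open import Data.Bool using (Bool; true; false; _∧_; if_then_else_; T)
open import Data.Bool.Properties using (∧-zeroʳ)
import Data.Fin as Fin
open import Data.Fin.Properties using () renaming (_≟_ to _≟ᶠ_)
open import Data.Integer as ℤ using (+_)
import Data.Integer.Properties as ℤ
open import Data.List using (List; []; _∷_; _++_; map; length; filterᵇ; tabulate; allFin)
open import Data.List.Membership.Propositional using (_∈_)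
open import Data.List.Membership.Propositional.Properties
  using (∈-filter⁺; ∈-filter⁻; ∈-allFin; ∈-map⁺)
open import Data.List.Membership.Propositional.Properties.WithK using (unique∧set⇒bag)
open import Data.List.Properties using (filter-++; length-++; length-tabulate; map-∘)
open import Data.List.Relation.Binary.BagAndSetEquality using (∼bag⇒↭)
open import Data.List.Relation.Binary.Permutation.Propositional
  using (_↭_; ↭-refl; ↭-sym; prep; swap; module PermutationReasoning)
  renaming (refl to ↭refl; trans to ↭trans)
import Data.List.Relation.Binary.Permutation.Propositional.Properties as ↭
open import Data.List.Relation.Unary.All as All using (All; []; _∷_)
open import Data.List.Relation.Unary.Any using (here; there)
open import Data.List.Relation.Unary.AllPairs using ([]; _∷_)
open import Data.List.Relation.Unary.Unique.Propositional using (Unique)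
import Data.List.Relation.Unary.Unique.Propositional.Properties as Unique
open import Data.Maybe using (Maybe; just; nothing)
open import Data.Nat as ℕ using (zero; suc; s≤s; z≤n; NonZero)
open import Data.Nat.Combinatorics using (nCk+nC[k+1]≡[n+1]C[k+1]; k>n⇒nCk≡0)
import Data.Nat.DivMod as DM
open import Data.Nat.Divisibility using (divides-refl)
open import Data.Nat.ListAction using (sum)
open import Data.Nat.ListAction.Properties using (sum-↭)
open import Data.Nat.Primality using (prime⇒nonZero)
import Data.Nat.Properties as ℕ
import Data.Nat.Tactic.RingSolver as ℕ-Solver
open import Data.Product using (∃₂; _×_; _,_; proj₁; proj₂)
import Data.Rational.Properties as ℚ
open import Data.Rational.Unnormalised as ℚᵘ using (mkℚᵘ; *≡*)
import Data.Rational.Unnormalised.Properties as ℚᵘ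
open import Data.Unit using (⊤)
open import Data.Vec using (Vec; []; _∷_)
open import Function using (_∘_; id; mk⇔)
open import Level using (0ℓ)
open import Relation.Binary.Definitions using (tri<; tri≈; tri>)
open import Relation.Binary.PropositionalEquality
  using (_≢_; refl; sym; trans; cong; cong₂; subst; module ≡-Reasoning)
open import Relation.Nullary using (Dec; yes; no; ¬_; contradiction)
open import Relation.Nullary.Decidable using (⌊_⌋; dec⇒maybe; T?)
open import Tactic.RingSolver using (solve-∀)
import Tactic.RingSolver.Core.AlmostCommutativeRing as ACR

open CommutativeSemigroupProperties ℕ.+-commutativeSemigroup using (interchange; xy∙z≈xz∙y)

-- Decisions as truth values, and counting and summing over lists.

⌊⌋-⇔ : ∀ {P Q : Set} (P? : Dec P) (Q? : Dec Q) → (P → Q) → (Q → P) → ⌊ P? ⌋ ≡ ⌊ Q? ⌋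
⌊⌋-⇔ (yes p) (yes q) f g = refl
⌊⌋-⇔ (yes p) (no ¬q) f g = contradiction (f p) ¬q
⌊⌋-⇔ (no ¬p) (yes q) f g = contradiction (g q) ¬p
⌊⌋-⇔ (no ¬p) (no ¬q) f g = refl

⌊⌋-true : ∀ {P : Set} (P? : Dec P) → P → ⌊ P? ⌋ ≡ true
⌊⌋-true (yes _) p = refl
⌊⌋-true (no ¬p) p = contradiction p ¬p

⌊⌋-false : ∀ {P : Set} (P? : Dec P) → ¬ P → ⌊ P? ⌋ ≡ false
⌊⌋-false (yes p) ¬p = contradiction p ¬p
⌊⌋-false (no _)  ¬p = refl

𝟙 : Bool → ℕ
𝟙 b = if b then 1 else 0

module _ {A : Set} where

  count : (A → Bool) → List A → ℕ
  count P xs = length (filterᵇ P xs)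

  count-cong : ∀ {P Q : A → Bool} → (∀ x → P x ≡ Q x) → ∀ xs → count P xs ≡ count Q xs
  count-cong P≗Q [] = refl
  count-cong {P} {Q} P≗Q (x ∷ xs) with P x | Q x | P≗Q x
  ... | true  | .true  | refl = cong suc (count-cong P≗Q xs)
  ... | false | .false | refl = count-cong P≗Q xs

  count-none : ∀ {P : A → Bool} → (∀ x → P x ≡ false) → ∀ xs → count P xs ≡ 0
  count-none ¬P [] = refl
  count-none {P} ¬P (x ∷ xs) with P x | ¬P x
  ... | .false | refl = count-none ¬P xs

  count-++ : ∀ (P : A → Bool) xs ys → count P (xs ++ ys) ≡ count P xs ℕ.+ count P ys
  count-++ P xs ys = trans (cong length (filter-++ (T? ∘ P) xs ys)) (length-++ (filterᵇ P xs))

  sum-map-+ : ∀ (f g : A → ℕ) xs →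
    sum (map (λ x → f x ℕ.+ g x) xs) ≡ sum (map f xs) ℕ.+ sum (map g xs)
  sum-map-+ f g []       = refl
  sum-map-+ f g (x ∷ xs) = trans (cong (f x ℕ.+ g x ℕ.+_) (sum-map-+ f g xs))
    (interchange (f x) (g x) (sum (map f xs)) (sum (map g xs)))

  sum-map-const : ∀ {f : A → ℕ} {c} {xs} → All (λ x → f x ≡ c) xs →
    sum (map f xs) ≡ length xs ℕ.* c
  sum-map-const []         = refl
  sum-map-const (eq ∷ eqs) = cong₂ ℕ._+_ eq (sum-map-const eqs)

  -- Runs over positions and hands `f` the remaining entries, so that the double counting of pairs
  -- (y, A) with y in A needs no deletion of y by an equality test.
  sumPicks : (A → List A → ℕ) → List A → ℕ
  sumPicks f []       = 0
  sumPicks f (x ∷ xs) = f x xs ℕ.+ sumPicks (λ y ys → f y (x ∷ ys)) xs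

  sumPicks-cong : ∀ {f g : A → List A → ℕ} → (∀ y ys → f y ys ≡ g y ys) →
    ∀ xs → sumPicks f xs ≡ sumPicks g xs
  sumPicks-cong f≗g []       = refl
  sumPicks-cong f≗g (x ∷ xs) = cong₂ ℕ._+_ (f≗g x xs) (sumPicks-cong (λ y ys → f≗g y (x ∷ ys)) xs)

  sumPicks-+ : ∀ (f g : A → List A → ℕ) xs →
    sumPicks (λ y ys → f y ys ℕ.+ g y ys) xs ≡ sumPicks f xs ℕ.+ sumPicks g xs
  sumPicks-+ f g []       = refl
  sumPicks-+ f g (x ∷ xs) = trans
    (cong (f x xs ℕ.+ g x xs ℕ.+_) (sumPicks-+ (λ y ys → f y (x ∷ ys)) (λ y ys → g y (x ∷ ys)) xs))
    (interchange (f x xs) (g x xs) _ _)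

  -- The permutation `xs ↭ y ∷ ys` is all that the double counting has to know about the rest `ys`;
  -- it survives the recursion by moving the skipped `x` behind `y`.
  sumPicks-const : ∀ {f : A → List A → ℕ} {c} xs → (∀ y ys → xs ↭ y ∷ ys → f y ys ≡ c) →
    sumPicks f xs ≡ length xs ℕ.* c
  sumPicks-const []       f≡c = refl
  sumPicks-const (x ∷ xs) f≡c = cong₂ ℕ._+_ (f≡c x xs ↭-refl)
    (sumPicks-const xs (λ y ys xs↭ → f≡c y (x ∷ ys) (↭trans (prep x xs↭) (swap x y ↭-refl))))

  -- Without repetitions, equality as sets is equality as bags, and bag equality is permutation.
  unique⇒↭ : ∀ {xs ys : List A} → Unique xs → Unique ys → (∀ x → x ∈ xs) → (∀ x → x ∈ ys) → xs ↭ ys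
  unique⇒↭ !xs !ys ∈xs ∈ys =
    ∼bag⇒↭ (unique∧set⇒bag !xs !ys (λ {x} → mk⇔ (λ _ → ∈ys x) (λ _ → ∈xs x)))

count-map : ∀ {A B : Set} (P : B → Bool) (f : A → B) xs → count P (map f xs) ≡ count (P ∘ f) xs
count-map P f []       = refl
count-map P f (x ∷ xs) with P (f x)
... | true  = cong suc (count-map P f xs)
... | false = count-map P f xs

nC0≡1 : ∀ n → n C 0 ≡ 1
nC0≡1 n = refl

map-allFin-↭ : ∀ {n} (f g : Fin n → Fin n) → (∀ x → g (f x) ≡ x) → (∀ x → f (g x) ≡ x) →
  map f (allFin n) ↭ allFin n
map-allFin-↭ {n} f g gf fg = unique⇒↭
  (Unique.map⁺ (λ {x} {y} eq → trans (sym (gf x)) (trans (cong g eq) (gf y))) (Unique.allFin⁺ n))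
  (Unique.allFin⁺ n)
  (λ x → subst (_∈ map f (allFin n)) (fg x) (∈-map⁺ f (∈-allFin (g x))))
  ∈-allFin

-- Subset sums over lists of field elements.

module SubsetSums {q : ℕ} (F : FiniteField q) where

  open FiniteField F using (isCommutativeRing; 0#; 1#; 0≢1; inverse)
    renaming (_+_ to infixl 6 _⊕_; _*_ to infixl 7 _⊛_; -_ to infix 8 ⊖_)

  ring : CommutativeRing 0ℓ 0ℓ
  ring = record { isCommutativeRing = isCommutativeRing }

  open CommutativeRing ring
    using (+-assoc; +-comm; +-identityˡ; +-identityʳ; *-comm; *-assoc; *-identityˡ; distribˡ; distribʳ;
           zeroˡ; zeroʳ; -‿inverseˡ; -‿inverseʳ; +-abelianGroup)
  open AbelianGroupProperties +-abelianGroup using (∙-cancelʳ; ∙-cancelˡ)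

  +-exchange : ∀ a x y → a ⊕ x ⊕ y ≡ a ⊕ y ⊕ x
  +-exchange a x y = trans (+-assoc a x y) (trans (cong (a ⊕_) (+-comm x y)) (sym (+-assoc a y x)))

  +-translate : ∀ a t x m → a ⊕ (t ⊕ x) ⊕ m ≡ a ⊕ (t ⊕ m) ⊕ x
  +-translate a t x m = begin
    a ⊕ (t ⊕ x) ⊕ m ≡⟨ cong (_⊕ m) (+-assoc a t x) ⟨
    a ⊕ t ⊕ x ⊕ m   ≡⟨ +-exchange (a ⊕ t) x m ⟩
    a ⊕ t ⊕ m ⊕ x   ≡⟨ cong (_⊕ x) (+-assoc a t m) ⟩
    a ⊕ (t ⊕ m) ⊕ x ∎
    where open ≡-Reasoning

  x-y+y : ∀ x y → x ⊕ ⊖ y ⊕ y ≡ x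
  x-y+y x y = trans (+-assoc x (⊖ y) y) (trans (cong (x ⊕_) (-‿inverseˡ y)) (+-identityʳ x))

  ⊛-cancelˡ : ∀ {u} x y → u ≢ 0# → u ⊛ x ≡ u ⊛ y → x ≡ y
  ⊛-cancelˡ {u} x y u≢0 eq = trans (sym (v*u* x)) (trans (cong (v ⊛_) eq) (v*u* y))
    where
    v = proj₁ (inverse u u≢0)
    v*u* : ∀ z → v ⊛ (u ⊛ z) ≡ z
    v*u* z = trans (sym (*-assoc v u z)) (trans (cong (_⊛ z)
      (trans (*-comm v u) (proj₂ (inverse u u≢0)))) (*-identityˡ z))

  natF-+ : ∀ m n → natF F (m ℕ.+ n) ≡ natF F m ⊕ natF F n
  natF-+ zero    n = sym (+-identityˡ _)
  natF-+ (suc m) n = trans (cong (1# ⊕_) (natF-+ m n)) (sym (+-assoc 1# _ _))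

  natF-suc-* : ∀ k t → natF F (suc k) ⊛ t ≡ t ⊕ natF F k ⊛ t
  natF-suc-* k t = trans (distribʳ t 1# (natF F k)) (cong (_⊕ natF F k ⊛ t) (*-identityˡ t))

  -- The number of k-element sublists of xs whose sum is b - a. Carrying the
  -- offset a keeps every identity below free of subtraction.
  cnt : List (Fin q) → ℕ → Fin q → Fin q → ℕ
  cnt xs       zero    a b = 𝟙 ⌊ a ≟ᶠ b ⌋
  cnt []       (suc k) a b = 0
  cnt (x ∷ xs) (suc k) a b = cnt xs (suc k) a b ℕ.+ cnt xs k (a ⊕ x) b

  -- Only a swap of two heads `x`, `y` needs an argument: the sublists split by which of the two
  -- they contain, and those with both agree because `a ⊕ x ⊕ y` is symmetric in `x` and `y`.
  cnt-↭ : ∀ {xs ys} → xs ↭ ys → ∀ k a b → cnt xs k a b ≡ cnt ys k a b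
  cnt-↭ p zero a b = refl
  cnt-↭ ↭refl (suc k) a b = refl
  cnt-↭ (prep x p) (suc k) a b = cong₂ ℕ._+_ (cnt-↭ p (suc k) a b) (cnt-↭ p k (a ⊕ x) b)
  cnt-↭ (↭trans p p′) (suc k) a b = trans (cnt-↭ p (suc k) a b) (cnt-↭ p′ (suc k) a b)
  -- A single pick cannot take both heads, so the fourth summand is missing here.
  cnt-↭ (swap {xs} x y p) (suc zero) a b =
    trans (xy∙z≈xz∙y (cnt xs 1 a b) _ _)
      (cong (λ n → n ℕ.+ 𝟙 ⌊ a ⊕ x ≟ᶠ b ⌋ ℕ.+ 𝟙 ⌊ a ⊕ y ≟ᶠ b ⌋) (cnt-↭ p 1 a b))
  cnt-↭ (swap {ys = ys} x y p) (suc (suc k)) a b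
    rewrite cnt-↭ p (suc (suc k)) a b | cnt-↭ p (suc k) (a ⊕ x) b | cnt-↭ p (suc k) (a ⊕ y) b
          | cnt-↭ p k (a ⊕ x ⊕ y) b | +-exchange a x y =
    interchange (cnt ys (suc (suc k)) a b) _ _ _

  -- Only the difference b - a matters; this trades a change of offset for a change of target.
  cnt-shift : ∀ xs k a b t → cnt xs k (a ⊕ t) (b ⊕ t) ≡ cnt xs k a b
  cnt-shift xs zero a b t =
    cong 𝟙 (⌊⌋-⇔ (a ⊕ t ≟ᶠ b ⊕ t) (a ≟ᶠ b) (∙-cancelʳ t a b) (cong (_⊕ t)))
  cnt-shift []       (suc k) a b t = refl
  cnt-shift (x ∷ xs) (suc k) a b t = cong₂ ℕ._+_ (cnt-shift xs (suc k) a b t)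
    (trans (cong (λ c → cnt xs k c (b ⊕ t)) (+-exchange a t x)) (cnt-shift xs k (a ⊕ x) b t))

  cnt-scale : ∀ {u} → u ≢ 0# → ∀ xs k a b → cnt (map (u ⊛_) xs) k (u ⊛ a) (u ⊛ b) ≡ cnt xs k a b
  cnt-scale {u} u≢0 xs zero a b =
    cong 𝟙 (⌊⌋-⇔ (u ⊛ a ≟ᶠ u ⊛ b) (a ≟ᶠ b) (⊛-cancelˡ a b u≢0) (cong (u ⊛_)))
  cnt-scale u≢0 []       (suc k) a b = refl
  cnt-scale {u} u≢0 (x ∷ xs) (suc k) a b = cong₂ ℕ._+_ (cnt-scale u≢0 xs (suc k) a b)
    (trans (cong (λ c → cnt (map (u ⊛_) xs) k c (u ⊛ b)) (sym (distribˡ u a x)))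
           (cnt-scale u≢0 xs k (a ⊕ x) b))

  -- Each of the `k` chosen entries contributes one `t`, and the total is charged to the offset.
  cnt-translate : ∀ t xs k a b → cnt (map (t ⊕_) xs) k a b ≡ cnt xs k (a ⊕ natF F k ⊛ t) b
  cnt-translate t xs zero a b =
    cong (λ c → 𝟙 ⌊ c ≟ᶠ b ⌋) (sym (trans (cong (a ⊕_) (zeroˡ t)) (+-identityʳ a)))
  cnt-translate t []       (suc k) a b = refl
  cnt-translate t (x ∷ xs) (suc k) a b = cong₂ ℕ._+_ (cnt-translate t xs (suc k) a b)
    (trans (cnt-translate t xs k (a ⊕ (t ⊕ x)) b) (cong (λ c → cnt xs k c b)
      (trans (+-translate a t x _) (cong (λ c → a ⊕ c ⊕ x) (sym (natF-suc-* k t))))))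

  -- Both sides count the pairs (y, A), where A is a sublist of size k + 1 with the required sum and
  -- y is one of its entries.
  cnt-picks : ∀ xs k a b →
    suc k ℕ.* cnt xs (suc k) a b ≡ sumPicks (λ y ys → cnt ys k (a ⊕ y) b) xs
  cnt-picks [] k a b = ℕ.*-zeroʳ k
  cnt-picks (x ∷ xs) zero a b = trans (regroup (cnt xs 1 a b) _)
    (cong (𝟙 ⌊ a ⊕ x ≟ᶠ b ⌋ ℕ.+_) (cnt-picks xs 0 a b))
    where
    regroup : ∀ m n → 1 ℕ.* (m ℕ.+ n) ≡ n ℕ.+ 1 ℕ.* m
    regroup = ℕ-Solver.solve-∀
  cnt-picks (x ∷ xs) (suc k) a b = begin
    suc (suc k) ℕ.* (m ℕ.+ n)
      -- Of the k + 2 copies of `n`, one is the pick of `x` itself; the other k + 1 are picks from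
      -- `xs` in sublists that contain `x`.
      ≡⟨ regroup k m n ⟩
    n ℕ.+ (suc (suc k) ℕ.* m ℕ.+ suc k ℕ.* n)
      ≡⟨ cong (n ℕ.+_) (cong₂ ℕ._+_ (cnt-picks xs (suc k) a b) (cnt-picks xs k (a ⊕ x) b)) ⟩
    n ℕ.+ (sumPicks (λ y ys → cnt ys (suc k) (a ⊕ y) b) xs
           ℕ.+ sumPicks (λ y ys → cnt ys k (a ⊕ x ⊕ y) b) xs)
      ≡⟨ cong (n ℕ.+_) (sumPicks-+ _ _ xs) ⟨
    n ℕ.+ sumPicks (λ y ys → cnt ys (suc k) (a ⊕ y) b ℕ.+ cnt ys k (a ⊕ x ⊕ y) b) xs
      ≡⟨ cong (n ℕ.+_) (sumPicks-cong (λ y ys → cong (λ c → cnt ys (suc k) (a ⊕ y) b ℕ.+ cnt ys k c b)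
           (+-exchange a x y)) xs) ⟩
    n ℕ.+ sumPicks (λ y ys → cnt (x ∷ ys) (suc k) (a ⊕ y) b) xs
      ∎
    where
    open ≡-Reasoning
    m = cnt xs (suc (suc k)) a b
    n = cnt xs (suc k) (a ⊕ x) b
    regroup : ∀ k m n → suc (suc k) ℕ.* (m ℕ.+ n) ≡ n ℕ.+ (suc (suc k) ℕ.* m ℕ.+ suc k ℕ.* n)
    regroup = ℕ-Solver.solve-∀

  -- From characteristic vectors to sublists.

  isSubsetSum : ∀ {n} → (Fin q → Bool) → (Fin n → Fin q) → ℕ → Fin q → Fin q → Vec Bool n → Bool
  isSubsetSum D f k a b s =
    ⌊ card s ℕ.≟ k ⌋ ∧ within D s f ∧ ⌊ a ⊕ FiniteField.sumSub F s f ≟ᶠ b ⌋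

  -- Induction on the first bit. The position map `f` and the offset `a` are general because a
  -- chosen first element is absorbed into the offset while `f` passes to the remaining positions.
  count-subsets : ∀ D n (f : Fin n → Fin q) k a b →
    count (isSubsetSum D f k a b) (allSubsets n) ≡ cnt (filterᵇ D (tabulate f)) k a b
  count-subsets D zero f zero a b rewrite +-identityʳ a with ⌊ a ≟ᶠ b ⌋
  ... | true  = refl
  ... | false = refl
  count-subsets D zero f (suc k) a b = refl
  count-subsets D (suc n) f k a b = begin
    count P (map (true ∷_) (allSubsets n) ++ map (false ∷_) (allSubsets n))
      ≡⟨ count-++ P (map (true ∷_) (allSubsets n)) _ ⟩
    count P (map (true ∷_) (allSubsets n)) ℕ.+ count P (map (false ∷_) (allSubsets n))
      ≡⟨ cong₂ ℕ._+_ (count-map P (true ∷_) (allSubsets n))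
           (trans (count-map P (false ∷_) (allSubsets n)) (count-subsets D n (f ∘ Fin.suc) k a b)) ⟩
    count (P ∘ (true ∷_)) (allSubsets n) ℕ.+ cnt (filterᵇ D (tabulate (f ∘ Fin.suc))) k a b
      ≡⟨ split k ⟩
    cnt (filterᵇ D (tabulate f)) k a b
      ∎
    where
    open ≡-Reasoning
    P = isSubsetSum D f k a b
    split : ∀ k →
      count (isSubsetSum D f k a b ∘ (true ∷_)) (allSubsets n) ℕ.+ cnt (filterᵇ D (tabulate (f ∘ Fin.suc))) k a b
        ≡ cnt (filterᵇ D (tabulate f)) k a b
    split zero = cong (ℕ._+ 𝟙 ⌊ a ≟ᶠ b ⌋) (count-none (λ s → refl) (allSubsets n))
    split (suc k) with D (f Fin.zero)
    ... | false = cong (ℕ._+ cnt (filterᵇ D (tabulate (f ∘ Fin.suc))) (suc k) a b)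
                    (count-none (λ s → ∧-zeroʳ _) (allSubsets n))
    ... | true  = trans (ℕ.+-comm (count _ (allSubsets n)) _)
                    (cong (cnt (filterᵇ D (tabulate (f ∘ Fin.suc))) (suc k) a b ℕ.+_)
                      (trans (count-cong same (allSubsets n))
                             (count-subsets D n (f ∘ Fin.suc) k (a ⊕ f Fin.zero) b)))
      where
      same : ∀ s → ⌊ suc (card s) ℕ.≟ suc k ⌋ ∧ within D s (f ∘ Fin.suc)
                     ∧ ⌊ a ⊕ (f Fin.zero ⊕ FiniteField.sumSub F s (f ∘ Fin.suc)) ≟ᶠ b ⌋
                 ≡ isSubsetSum D (f ∘ Fin.suc) k (a ⊕ f Fin.zero) b s
      same s = cong₂ (λ u c → u ∧ within D s (f ∘ Fin.suc) ∧ ⌊ c ≟ᶠ b ⌋)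
        (⌊⌋-⇔ (suc (card s) ℕ.≟ suc k) (card s ℕ.≟ k) ℕ.suc-injective (cong suc))
        (sym (+-assoc a (f Fin.zero) _))

  N≡cnt : ∀ D k b → N F D k b ≡ cnt (filterᵇ D (allFin q)) k 0# b
  N≡cnt D k b = trans
    (count-cong (λ s → cong (λ c → ⌊ card s ℕ.≟ k ⌋ ∧ within D s id ∧ ⌊ c ≟ᶠ b ⌋)
      (sym (+-identityˡ _))) (allSubsets q))
    (count-subsets D q id k 0# b)

  -- `F∖0` puts `1#` in front of `F∖01`, so that the recursion from `N₁` to `N₂` is an unfolding of
  -- `cnt`; `allFin↭` shows that only 0 is missing from it.
  F∖01 F∖0 : List (Fin q)
  F∖01 = filterᵇ (noZeroOne F) (allFin q)
  F∖0  = 1# ∷ F∖01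

  noZeroOne⁺ : ∀ {x} → x ≢ 0# → x ≢ 1# → T (noZeroOne F x)
  noZeroOne⁺ {x} x≢0 x≢1 with x ≟ᶠ 0# | x ≟ᶠ 1#
  ... | yes x≡0 | _       = contradiction x≡0 x≢0
  ... | no _    | yes x≡1 = contradiction x≡1 x≢1
  ... | no _    | no _    = _

  noZeroOne⁻ : ∀ {x} → T (noZeroOne F x) → x ≢ 0# × x ≢ 1#
  noZeroOne⁻ {x} t with x ≟ᶠ 0# | x ≟ᶠ 1#
  ... | no x≢0 | no x≢1 = x≢0 , x≢1

  F∖01-≢ : ∀ {x} → x ∈ F∖01 → x ≢ 0# × x ≢ 1#
  F∖01-≢ x∈ = noZeroOne⁻ (proj₂ (∈-filter⁻ (T? ∘ noZeroOne F) {xs = allFin q} x∈))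

  F∖0-≢0 : All (_≢ 0#) F∖0
  F∖0-≢0 = (0≢1 ∘ sym) ∷ All.tabulate (proj₁ ∘ F∖01-≢)

  allFin↭ : allFin q ↭ 0# ∷ F∖0
  allFin↭ = unique⇒↭ (Unique.allFin⁺ q) unique ∈-allFin everything
    where
    unique : Unique (0# ∷ F∖0)
    unique = All.map (_∘ sym) F∖0-≢0
           ∷ All.tabulate (λ x∈ → proj₂ (F∖01-≢ x∈) ∘ sym)
           ∷ Unique.filter⁺ (T? ∘ noZeroOne F) (Unique.allFin⁺ q)
    everything : ∀ x → x ∈ 0# ∷ F∖0
    everything x with x ≟ᶠ 0# | x ≟ᶠ 1#
    ... | yes x≡0 | _       = here x≡0
    ... | no _    | yes x≡1 = there (here x≡1)
    ... | no x≢0  | no x≢1  =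
      there (there (∈-filter⁺ (T? ∘ noZeroOne F) (∈-allFin x) (noZeroOne⁺ x≢0 x≢1)))

  q≡ : q ≡ suc (suc (length F∖01))
  q≡ = trans (sym (length-tabulate id)) (↭.↭-length allFin↭)

  +-allFin↭ : ∀ t → map (t ⊕_) (allFin q) ↭ allFin q
  +-allFin↭ t = map-allFin-↭ (t ⊕_) (⊖ t ⊕_)
    (λ x → trans (sym (+-assoc (⊖ t) t x)) (trans (cong (_⊕ x) (-‿inverseˡ t)) (+-identityˡ x)))
    (λ x → trans (sym (+-assoc t (⊖ t) x)) (trans (cong (_⊕ x) (-‿inverseʳ t)) (+-identityˡ x)))

  -- Multiplication by a nonzero `u` permutes the whole field and fixes 0, which can then be dropped
  -- on both sides.
  *-F∖0↭ : ∀ {u} → u ≢ 0# → map (u ⊛_) F∖0 ↭ F∖0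
  *-F∖0↭ {u} u≢0 = ↭.drop-∷ (begin
    0# ∷ map (u ⊛_) F∖0     ≡⟨ cong (_∷ map (u ⊛_) F∖0) (zeroʳ u) ⟨
    map (u ⊛_) (0# ∷ F∖0)   ↭⟨ ↭.map⁺ (u ⊛_) allFin↭ ⟨
    map (u ⊛_) (allFin q)   ↭⟨ map-allFin-↭ (u ⊛_) (v ⊛_) (λ x → ⊛-assoc-id v u x vu≡1) (λ x → ⊛-assoc-id u v x uv≡1) ⟩
    allFin q                ↭⟨ allFin↭ ⟩
    0# ∷ F∖0                ∎)
    where
    open PermutationReasoning
    v = proj₁ (inverse u u≢0)
    uv≡1 = proj₂ (inverse u u≢0)
    vu≡1 = trans (*-comm v u) uv≡1
    ⊛-assoc-id : ∀ y z x → y ⊛ z ≡ 1# → y ⊛ (z ⊛ x) ≡ x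
    ⊛-assoc-id y z x yz≡1 = trans (sym (*-assoc y z x)) (trans (cong (_⊛ x) yz≡1) (*-identityˡ x))

  sum-allFin : ∀ {f : Fin q → ℕ} {c} → (∀ b → b ≢ 0# → f b ≡ c) →
    sum (map f (allFin q)) ≡ f 0# ℕ.+ length F∖0 ℕ.* c
  sum-allFin {f} f≡c = trans (sum-↭ (↭.map⁺ f allFin↭))
    (cong (f 0# ℕ.+_) (sum-map-const (All.map (f≡c _) F∖0-≢0)))

  -- Every sublist has exactly one sum, so summing over all targets leaves only the number of
  -- k-element sublists; the recursion is Pascal's rule.
  sum-cnt : ∀ xs k a → sum (map (cnt xs k a) (allFin q)) ≡ length xs C k
  sum-cnt xs zero a = begin
    sum (map (λ b → 𝟙 ⌊ a ≟ᶠ b ⌋) (allFin q))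
      -- Reindexing by `a ⊕ b` puts the only hit at b = 0, where `sum-allFin` can separate it.
      ≡⟨ sum-↭ (↭.map⁺ (λ b → 𝟙 ⌊ a ≟ᶠ b ⌋) (+-allFin↭ a)) ⟨
    sum (map (λ b → 𝟙 ⌊ a ≟ᶠ b ⌋) (map (a ⊕_) (allFin q)))
      ≡⟨ cong sum (map-∘ (allFin q)) ⟨
    sum (map (λ b → 𝟙 ⌊ a ≟ᶠ a ⊕ b ⌋) (allFin q))
      ≡⟨ sum-allFin (λ b b≢0 → cong 𝟙 (⌊⌋-false (a ≟ᶠ a ⊕ b)
           (λ eq → b≢0 (∙-cancelˡ a b 0# (trans (sym eq) (sym (+-identityʳ a))))))) ⟩
    𝟙 ⌊ a ≟ᶠ a ⊕ 0# ⌋ ℕ.+ length F∖0 ℕ.* 0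
      ≡⟨ cong₂ ℕ._+_ (cong 𝟙 (⌊⌋-true (a ≟ᶠ a ⊕ 0#) (sym (+-identityʳ a)))) (ℕ.*-zeroʳ (length F∖0)) ⟩
    1 ≡⟨ nC0≡1 (length xs) ⟨
    length xs C 0 ∎
    where open ≡-Reasoning
  sum-cnt [] (suc k) a = trans
    (sum-map-const {f = cnt [] (suc k) a} {xs = allFin q} (All.universal (λ _ → refl) (allFin q)))
    (trans (ℕ.*-zeroʳ (length (allFin q))) (sym (k>n⇒nCk≡0 {0} {suc k} (s≤s z≤n))))
  sum-cnt (x ∷ xs) (suc k) a = begin
    sum (map (cnt (x ∷ xs) (suc k) a) (allFin q))
      ≡⟨ sum-map-+ (cnt xs (suc k) a) (cnt xs k (a ⊕ x)) (allFin q) ⟩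
    sum (map (cnt xs (suc k) a) (allFin q)) ℕ.+ sum (map (cnt xs k (a ⊕ x)) (allFin q))
      ≡⟨ cong₂ ℕ._+_ (sum-cnt xs (suc k) a) (sum-cnt xs k (a ⊕ x)) ⟩
    length xs C suc k ℕ.+ length xs C k
      ≡⟨ ℕ.+-comm (length xs C suc k) _ ⟩
    length xs C k ℕ.+ length xs C suc k
      ≡⟨ nCk+nC[k+1]≡[n+1]C[k+1] (length xs) k ⟩
    suc (length xs) C suc k ∎
    where open ≡-Reasoning

  -- The counts for the field, without 0, and without 0 and 1.

  N₀ N₁ N₂ : ℕ → Fin q → ℕ
  N₀ k b = cnt (allFin q) k 0# b
  N₁ k b = cnt F∖0 k 0# b
  N₂ k b = cnt F∖01 k 0# b

  N₀-suc : ∀ k b → N₀ (suc k) b ≡ N₁ (suc k) b ℕ.+ N₁ k b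
  N₀-suc k b = trans (cnt-↭ allFin↭ (suc k) 0# b)
    (cong (λ c → N₁ (suc k) b ℕ.+ cnt F∖0 k c b) (+-identityʳ 0#))

  N₁-suc : ∀ k b → N₁ (suc k) b ≡ N₂ (suc k) b ℕ.+ N₂ k (b ⊕ ⊖ 1#)
  N₁-suc k b = cong (N₂ (suc k) b ℕ.+_)
    (trans (cong (cnt F∖01 k (0# ⊕ 1#)) (sym (x-y+y b 1#))) (cnt-shift F∖01 k 0# (b ⊕ ⊖ 1#) 1#))

  -- Scaling by `b` permutes the nonzero elements and takes sum 1 to sum `b`.
  N₁-≢0 : ∀ k {b} → b ≢ 0# → N₁ k b ≡ N₁ k 1#
  N₁-≢0 k {b} b≢0 = begin
    cnt F∖0 k 0# b                            ≡⟨ cnt-↭ (*-F∖0↭ b≢0) k 0# b ⟨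
    cnt (map (b ⊛_) F∖0) k 0# b               ≡⟨ cong₂ (cnt (map (b ⊛_) F∖0) k) (zeroʳ b) (trans (*-comm b 1#) (*-identityˡ b)) ⟨
    cnt (map (b ⊛_) F∖0) k (b ⊛ 0#) (b ⊛ 1#)  ≡⟨ cnt-scale b≢0 F∖0 k 0# 1# ⟩
    cnt F∖0 k 0# 1#                           ∎
    where open ≡-Reasoning

  sum-N₁ : ∀ k → N₁ k 0# ℕ.+ length F∖0 ℕ.* N₁ k 1# ≡ length F∖0 C k
  sum-N₁ k = trans (sym (sum-allFin (λ b b≢0 → N₁-≢0 k b≢0))) (sum-cnt F∖0 k 0#)

  -- Translating by b / k moves the sum of every k-subset by b.
  N₀-const : ∀ k → natF F k ≢ 0# → ∀ b → N₀ k b ≡ N₀ k 0#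
  N₀-const k k≢0 b = begin
    cnt (allFin q) k 0# b                      ≡⟨ cnt-↭ (+-allFin↭ t) k 0# b ⟨
    cnt (map (t ⊕_) (allFin q)) k 0# b         ≡⟨ cnt-translate t (allFin q) k 0# b ⟩
    cnt (allFin q) k (0# ⊕ natF F k ⊛ t) b     ≡⟨ cong₂ (cnt (allFin q) k) (cong (0# ⊕_) kt≡b) (sym (+-identityˡ b)) ⟩
    cnt (allFin q) k (0# ⊕ b) (0# ⊕ b)         ≡⟨ cnt-shift (allFin q) k 0# 0# b ⟩
    cnt (allFin q) k 0# 0#                     ∎
    where
    open ≡-Reasoning
    k⁻¹ = proj₁ (inverse (natF F k) k≢0)
    t = k⁻¹ ⊛ b
    kt≡b : natF F k ⊛ t ≡ b
    kt≡b = trans (sym (*-assoc (natF F k) k⁻¹ b))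
      (trans (cong (_⊛ b) (proj₂ (inverse (natF F k) k≢0))) (*-identityˡ b))

  -- Double counting of the pairs (y, A) with y ∈ A: translating A by - y moves
  -- y to 0 and, as k · 1 = 0, does not change the sum of A.
  N₀-count : ∀ k → natF F (suc k) ≡ 0# → ∀ b → suc k ℕ.* N₀ (suc k) b ≡ q ℕ.* N₁ k b
  N₀-count k k≡0 b = begin
    suc k ℕ.* cnt (allFin q) (suc k) 0# b
      ≡⟨ cnt-picks (allFin q) k 0# b ⟩
    sumPicks (λ y ys → cnt ys k (0# ⊕ y) b) (allFin q)
      ≡⟨ sumPicks-const (allFin q) pick ⟩
    length (allFin q) ℕ.* N₁ k b
      ≡⟨ cong (ℕ._* N₁ k b) (length-tabulate {n = q} id) ⟩
    q ℕ.* N₁ k b ∎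
    where
    open ≡-Reasoning
    rest↭ : ∀ y ys → allFin q ↭ y ∷ ys → ys ↭ map (y ⊕_) F∖0
    rest↭ y ys p = ↭.drop-∷ (↭trans (↭-sym p) (↭trans (↭-sym (+-allFin↭ y))
      (subst (λ z → map (y ⊕_) (allFin q) ↭ z ∷ map (y ⊕_) F∖0) (+-identityʳ y) (↭.map⁺ (y ⊕_) allFin↭))))
    pick : ∀ y ys → allFin q ↭ y ∷ ys → cnt ys k (0# ⊕ y) b ≡ N₁ k b
    pick y ys p = begin
      cnt ys k (0# ⊕ y) b                     ≡⟨ cnt-↭ (rest↭ y ys p) k (0# ⊕ y) b ⟩
      cnt (map (y ⊕_) F∖0) k (0# ⊕ y) b       ≡⟨ cnt-translate y F∖0 k (0# ⊕ y) b ⟩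
      cnt F∖0 k (0# ⊕ y ⊕ natF F k ⊛ y) b     ≡⟨ cong (λ c → cnt F∖0 k c b) offset ⟩
      cnt F∖0 k 0# b                          ∎
      where
      offset : 0# ⊕ y ⊕ natF F k ⊛ y ≡ 0#
      offset = trans (+-assoc 0# y _) (trans (+-identityˡ _)
        (trans (sym (natF-suc-* k y)) (trans (cong (_⊛ y) k≡0) (zeroˡ y))))

-- Rational arithmetic and binomial coefficients.

ℚ-ring : ACR.AlmostCommutativeRing 0ℓ 0ℓ
ℚ-ring = ACR.fromCommutativeRing ℚ.+-*-commutativeRing (λ x → dec⇒maybe (ℚ.0ℚ ℚ.≟ x))

-- Unnormalised fractions add and multiply without reduction to lowest terms; carrying this over
-- lets the identities for `ℕ→ℚ` and `_/_` be checked there by cross-multiplication.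
fromℚᵘ-+ : ∀ x y → ℚ.fromℚᵘ (x ℚᵘ.+ y) ≡ ℚ.fromℚᵘ x + ℚ.fromℚᵘ y
fromℚᵘ-+ x y = ℚ.toℚᵘ-injective (ℚᵘ.≃-trans (ℚ.toℚᵘ-fromℚᵘ (x ℚᵘ.+ y))
  (ℚᵘ.≃-sym (ℚᵘ.≃-trans (ℚ.toℚᵘ-homo-+ (ℚ.fromℚᵘ x) (ℚ.fromℚᵘ y))
    (ℚᵘ.+-cong (ℚ.toℚᵘ-fromℚᵘ x) (ℚ.toℚᵘ-fromℚᵘ y)))))

fromℚᵘ-* : ∀ x y → ℚ.fromℚᵘ (x ℚᵘ.* y) ≡ ℚ.fromℚᵘ x * ℚ.fromℚᵘ y
fromℚᵘ-* x y = ℚ.toℚᵘ-injective (ℚᵘ.≃-trans (ℚ.toℚᵘ-fromℚᵘ (x ℚᵘ.* y))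
  (ℚᵘ.≃-sym (ℚᵘ.≃-trans (ℚ.toℚᵘ-homo-* (ℚ.fromℚᵘ x) (ℚ.fromℚᵘ y))
    (ℚᵘ.*-cong (ℚ.toℚᵘ-fromℚᵘ x) (ℚ.toℚᵘ-fromℚᵘ y)))))

ℕ→ℚ-+ : ∀ m n → ℕ→ℚ (m ℕ.+ n) ≡ ℕ→ℚ m + ℕ→ℚ n
ℕ→ℚ-+ m n = trans
  (ℚ.fromℚᵘ-cong {mkℚᵘ (+ (m ℕ.+ n)) 0} {mkℚᵘ (+ m) 0 ℚᵘ.+ mkℚᵘ (+ n) 0}
    (*≡* (cong (λ z → z ℤ.* + 1) (sym (cong₂ ℤ._+_ (ℤ.*-identityʳ (+ m)) (ℤ.*-identityʳ (+ n)))))))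
  (fromℚᵘ-+ (mkℚᵘ (+ m) 0) (mkℚᵘ (+ n) 0))

ℕ→ℚ-* : ∀ m n → ℕ→ℚ (m ℕ.* n) ≡ ℕ→ℚ m * ℕ→ℚ n
ℕ→ℚ-* m n = trans
  (ℚ.fromℚᵘ-cong {mkℚᵘ (+ (m ℕ.* n)) 0} {mkℚᵘ (+ m) 0 ℚᵘ.* mkℚᵘ (+ n) 0}
    (*≡* (cong (λ z → z ℤ.* + 1) (ℤ.pos-* m n))))
  (fromℚᵘ-* (mkℚᵘ (+ m) 0) (mkℚᵘ (+ n) 0))

/-*-cancel : ∀ m n .{{_ : NonZero n}} → ((+ m) ℚ./ n) * ℕ→ℚ n ≡ ℕ→ℚ m
/-*-cancel m (suc n) = trans (sym (fromℚᵘ-* (mkℚᵘ (+ m) n) (mkℚᵘ (+ suc n) 0)))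
  (ℚ.fromℚᵘ-cong {mkℚᵘ (+ m) n ℚᵘ.* mkℚᵘ (+ suc n) 0} {mkℚᵘ (+ m) 0}
    (*≡* (trans (ℤ.*-identityʳ (+ m ℤ.* + suc n)) (cong (λ z → + m ℤ.* + suc z) (sym (ℕ.*-identityʳ n))))))

1/suc : ℕ → ℚ
1/suc n = (+ 1) ℚ./ suc n

-- Both sides are (y + 1) y (y - 1) ... (y + 1 - j) / j!. This is the source of Pascal's rule for a
-- rational upper argument.
binom-absorb : ∀ y j → binom (y + ℚ.1ℚ) j * (y + ℚ.1ℚ - ℕ→ℚ j) ≡ (y + ℚ.1ℚ) * binom y j
binom-absorb y zero    = unit y
  where
  unit : ∀ y → ℚ.1ℚ * (y + ℚ.1ℚ - ℚ.0ℚ) ≡ (y + ℚ.1ℚ) * ℚ.1ℚ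
  unit = solve-∀ ℚ-ring
binom-absorb y (suc j) = begin
  binom (y + ℚ.1ℚ) j * ((y + ℚ.1ℚ - ℕ→ℚ j) * i) * (y + ℚ.1ℚ - ℕ→ℚ (suc j))
    ≡⟨ cong (λ n → binom (y + ℚ.1ℚ) j * ((y + ℚ.1ℚ - ℕ→ℚ j) * i) * (y + ℚ.1ℚ - n)) (ℕ→ℚ-+ 1 j) ⟩
  binom (y + ℚ.1ℚ) j * ((y + ℚ.1ℚ - ℕ→ℚ j) * i) * (y + ℚ.1ℚ - (ℚ.1ℚ + ℕ→ℚ j))
    ≡⟨ left (binom (y + ℚ.1ℚ) j) y (ℕ→ℚ j) i ⟩
  binom (y + ℚ.1ℚ) j * (y + ℚ.1ℚ - ℕ→ℚ j) * ((y - ℕ→ℚ j) * i)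
    ≡⟨ cong (_* ((y - ℕ→ℚ j) * i)) (binom-absorb y j) ⟩
  (y + ℚ.1ℚ) * binom y j * ((y - ℕ→ℚ j) * i)
    ≡⟨ ℚ.*-assoc (y + ℚ.1ℚ) (binom y j) _ ⟩
  (y + ℚ.1ℚ) * (binom y j * ((y - ℕ→ℚ j) * i))
    ∎
  where
  open ≡-Reasoning
  i = 1/suc j
  left : ∀ b y n i → b * ((y + ℚ.1ℚ - n) * i) * (y + ℚ.1ℚ - (ℚ.1ℚ + n)) ≡ b * (y + ℚ.1ℚ - n) * ((y - n) * i)
  left = solve-∀ ℚ-ring

1/suc-*-suc : ∀ j → 1/suc j * (ℚ.1ℚ + ℕ→ℚ j) ≡ ℚ.1ℚ
1/suc-*-suc j = trans (cong (1/suc j *_) (sym (ℕ→ℚ-+ 1 j))) (/-*-cancel 1 (suc j))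

-- By absorption the left side is (y + 1) / (j + 1) times `binom y j`, and y + 1 = (y - j) + (j +
-- 1).
binom-pascal : ∀ y j → binom (y + ℚ.1ℚ) (suc j) ≡ binom y (suc j) + binom y j
binom-pascal y j = begin
  binom (y + ℚ.1ℚ) j * ((y + ℚ.1ℚ - n) * i)
    ≡⟨ ℚ.*-assoc (binom (y + ℚ.1ℚ) j) _ i ⟨
  binom (y + ℚ.1ℚ) j * (y + ℚ.1ℚ - n) * i
    ≡⟨ cong (_* i) (binom-absorb y j) ⟩
  (y + ℚ.1ℚ) * binom y j * i
    ≡⟨ split y (binom y j) n i ⟩
  binom y j * ((y - n) * i) + binom y j * (i * (ℚ.1ℚ + n))
    ≡⟨ cong (λ u → binom y j * ((y - n) * i) + binom y j * u) (1/suc-*-suc j) ⟩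
  binom y j * ((y - n) * i) + binom y j * ℚ.1ℚ
    ≡⟨ cong (λ u → binom y j * ((y - n) * i) + u) (ℚ.*-identityʳ (binom y j)) ⟩
  binom y j * ((y - n) * i) + binom y j
    ∎
  where
  open ≡-Reasoning
  i = 1/suc j
  n = ℕ→ℚ j
  split : ∀ y b n i → (y + ℚ.1ℚ) * b * i ≡ b * ((y - n) * i) + b * (i * (ℚ.1ℚ + n))
  split = solve-∀ ℚ-ring

-- Recursions for the coefficients.

𝟙ℚ : Bool → ℚ
𝟙ℚ b = if b then ℚ.1ℚ else ℚ.0ℚ

hasDigit : Maybe ℕ → ℕ → Bool
hasDigit nothing  r = false
hasDigit (just m) r = ⌊ m ℕ.≟ r ⌋

below : ℕ → Maybe ℕ → Set
below p nothing  = ⊤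
below p (just m) = m < p

module Coefficients (x : ℚ) (p : ℕ) where

  -- For x = q / p and k = j p + r, R j r is R²ₖ and T′ c j r is S(k, c), where c
  -- is given by its residue, if any.
  A E : ℕ → ℚ
  A j = sgn j * binom (x - ℕ→ℚ 2) j
  E j = sgn j * binom (x - ℚ.1ℚ) j

  R : ℕ → ℕ → ℚ
  R j r = (ℚ.- (ℕ→ℚ p * A j)) + ℕ→ℚ (p ∸ 1 ∸ r) * E j

  T′ : Maybe ℕ → ℕ → ℕ → ℚ
  T′ nothing  j r = ℚ.0ℚ
  T′ (just m) j r = (ℚ.- A j) + 𝟙ℚ ⌊ r ℕ.<? m ⌋ * E j

  -- Pascal's rule at x - 1 = (x - 2) + 1; the alternating sign turns its sum into a difference.
  E-suc : ∀ j → E (suc j) ≡ A (suc j) - A j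
  E-suc j = trans
    (cong (λ y → (ℚ.- sgn j) * y) (trans (cong (λ y → binom y (suc j)) (x-1 x)) (binom-pascal (x - ℕ→ℚ 2) j)))
    (regroup (sgn j) _ _)
    where
    x-1 : ∀ x → x - ℚ.1ℚ ≡ x - (ℚ.1ℚ + ℚ.1ℚ) + ℚ.1ℚ
    x-1 = solve-∀ ℚ-ring
    regroup : ∀ s b c → (ℚ.- s) * (b + c) ≡ (ℚ.- s) * b - s * c
    regroup = solve-∀ ℚ-ring

  -- Only the factor p - 1 - r changes; `suc r < p` keeps the truncated subtraction exact.
  R-suc : ∀ j r → suc r < p → R j (suc r) ≡ R j r - E j
  R-suc j r r+1<p = trans (regroup (ℕ→ℚ p * A j) (ℕ→ℚ (p ∸ 1 ∸ suc r)) (E j))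
    (cong (λ n → (ℚ.- (ℕ→ℚ p * A j)) + n * E j - E j)
      (trans (sym (ℕ→ℚ-+ 1 (p ∸ 1 ∸ suc r))) (cong ℕ→ℚ (sym (p-1-r p r+1<p)))))
    where
    p-1-r : ∀ p → suc r < p → p ∸ 1 ∸ r ≡ suc (p ∸ 1 ∸ suc r)
    p-1-r (suc p) (s≤s r<p) = ℕ.+-∸-assoc 1 r<p
    regroup : ∀ a n e → (ℚ.- a) + n * e ≡ (ℚ.- a) + (ℚ.1ℚ + n) * e - e
    regroup = solve-∀ ℚ-ring

  -- At r = p - 1 the `E` term vanishes. After the carry, `E-suc` turns -p A(j+1) + p E(j+1) into -p
  -- A(j), and one E(j+1) remains to be subtracted.
  R-carry : ∀ j r → suc r ≡ p → R (suc j) 0 ≡ R j r - E (suc j)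
  R-carry j r refl rewrite ℕ.n∸n≡0 r = trans
    (cong (λ n → (ℚ.- (n * A (suc j))) + ℕ→ℚ r * E (suc j)) (ℕ→ℚ-+ 1 r))
    (trans (regroup (ℕ→ℚ r) (A (suc j)) (A j) (E (suc j)) (E j) (E-suc j))
      (cong (λ n → (ℚ.- (n * A j)) + ℚ.0ℚ * E j - E (suc j)) (sym (ℕ→ℚ-+ 1 r))))
    where
    expand : ∀ n a′ a e → (ℚ.- ((ℚ.1ℚ + n) * a′)) + n * (a′ - a)
                           ≡ (ℚ.- ((ℚ.1ℚ + n) * a)) + ℚ.0ℚ * e - (a′ - a)
    expand = solve-∀ ℚ-ring
    regroup : ∀ n a′ a e′ e → e′ ≡ a′ - a →
      (ℚ.- ((ℚ.1ℚ + n) * a′)) + n * e′ ≡ (ℚ.- ((ℚ.1ℚ + n) * a)) + ℚ.0ℚ * e - e′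
    regroup n a′ a e′ e refl = expand n a′ a e

  T-zero : ∀ c → T′ c 0 0 ≡ ℚ.- 𝟙ℚ (hasDigit c 0)
  T-zero nothing        = refl
  T-zero (just zero)    = refl
  T-zero (just (suc m)) = refl

  -- Raising the digit to r + 1 changes δ only for the residue r + 1, where it falls from 1 to 0.
  T-suc : ∀ c j r → T′ c j (suc r) ≡ T′ c j r - 𝟙ℚ (hasDigit c (suc r)) * E j
  T-suc nothing  j r = zeros (E j)
    where
    zeros : ∀ e → ℚ.0ℚ ≡ ℚ.0ℚ - ℚ.0ℚ * e
    zeros = solve-∀ ℚ-ring
  T-suc (just m) j r = trans (cong (λ u → (ℚ.- A j) + u * E j) step) (regroup (A j) (𝟙ℚ ⌊ r ℕ.<? m ⌋) (𝟙ℚ ⌊ m ℕ.≟ suc r ⌋) (E j))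
    where
    regroup : ∀ a u v e → (ℚ.- a) + (u - v) * e ≡ (ℚ.- a) + u * e - v * e
    regroup = solve-∀ ℚ-ring
    step : 𝟙ℚ ⌊ suc r ℕ.<? m ⌋ ≡ 𝟙ℚ ⌊ r ℕ.<? m ⌋ - 𝟙ℚ ⌊ m ℕ.≟ suc r ⌋
    step with ℕ.<-cmp (suc r) m
    ... | tri< lt ne _ rewrite ⌊⌋-true (suc r ℕ.<? m) lt | ⌊⌋-true (r ℕ.<? m) (ℕ.<-trans (ℕ.n<1+n r) lt)
                             | ⌊⌋-false (m ℕ.≟ suc r) (ne ∘ sym) = refl
    ... | tri≈ nlt eq _ rewrite ⌊⌋-false (suc r ℕ.<? m) nlt | ⌊⌋-true (r ℕ.<? m) (ℕ.≤-reflexive eq)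
                             | ⌊⌋-true (m ℕ.≟ suc r) (sym eq) = refl
    ... | tri> nlt ne gt rewrite ⌊⌋-false (suc r ℕ.<? m) nlt | ⌊⌋-false (r ℕ.<? m) (ℕ.<⇒≱ gt)
                             | ⌊⌋-false (m ℕ.≟ suc r) (ne ∘ sym) = refl

  -- Since m ≤ p - 1 = r, δ is 0 before the carry; afterwards it is 1 unless m = 0. The rest is
  -- `E-suc`.
  T-carry : ∀ c j r → suc r ≡ p → below p c →
    T′ c (suc j) 0 ≡ T′ c j r - 𝟙ℚ (hasDigit c 0) * E (suc j)
  T-carry nothing  j r _ _ = zeros (E (suc j))
    where
    zeros : ∀ e → ℚ.0ℚ ≡ ℚ.0ℚ - ℚ.0ℚ * e
    zeros = solve-∀ ℚ-ring
  T-carry (just m) j r refl m<p rewrite ⌊⌋-false (r ℕ.<? m) (ℕ.<⇒≱ m<p) = trans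
    (cong (λ u → (ℚ.- A (suc j)) + u * E (suc j)) (step m))
    (regroup (A (suc j)) (A j) (E (suc j)) (E j) (𝟙ℚ ⌊ m ℕ.≟ 0 ⌋) (E-suc j))
    where
    step : ∀ m → 𝟙ℚ ⌊ 0 ℕ.<? m ⌋ ≡ ℚ.1ℚ - 𝟙ℚ ⌊ m ℕ.≟ 0 ⌋
    step zero    = refl
    step (suc m) = refl
    expand : ∀ a′ a e v → (ℚ.- a′) + (ℚ.1ℚ - v) * (a′ - a) ≡ (ℚ.- a) + ℚ.0ℚ * e - v * (a′ - a)
    expand = solve-∀ ℚ-ring
    regroup : ∀ a′ a e′ e v → e′ ≡ a′ - a →
      (ℚ.- a′) + (ℚ.1ℚ - v) * e′ ≡ (ℚ.- a) + ℚ.0ℚ * e - v * e′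
    regroup a′ a e′ e v refl = expand a′ a e v

-- Quotient and remainder modulo p by counting up.

module Digits (p : ℕ) where

  -- k = j p + r with 0 ≤ r < p.
  data Digits : ℕ → ℕ → ℕ → Set where
    start : 0 < p → Digits 0 0 0
    incr  : ∀ {k j r} → Digits k j r → suc r < p → Digits (suc k) j (suc r)
    carry : ∀ {k j r} → Digits k j r → suc r ≡ p → Digits (suc k) (suc j) 0

  digit<p : ∀ {k j r} → Digits k j r → r < p
  digit<p (start 0<p)       = 0<p
  digit<p (incr _ r<p)      = r<p
  digit<p (carry _ refl)    = s≤s z≤n

  digits-value : ∀ {k j r} → Digits k j r → k ≡ r ℕ.+ j ℕ.* p
  digits-value (start _)        = refl
  digits-value (incr d _)       = cong suc (digits-value d)
  digits-value (carry d refl)   = cong suc (digits-value d)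

  digits-exist : 0 < p → ∀ k → ∃₂ λ j r → Digits k j r
  digits-exist 0<p zero    = 0 , 0 , start 0<p
  digits-exist 0<p (suc k) with digits-exist 0<p k
  ... | j , r , d with suc r ℕ.≟ p
  ... | yes eq = suc j , 0 , carry d eq
  ... | no neq = j , suc r , incr d (ℕ.≤∧≢⇒< (digit<p d) neq)

  digits-/-% : .{{_ : NonZero p}} → ∀ {k j r} → Digits k j r → k DM./ p ≡ j × k DM.% p ≡ r
  digits-/-% {k} {j} {r} d with refl ← digits-value d =
      trans (DM.+-distrib-/-∣ʳ r (divides-refl j))
        (cong₂ ℕ._+_ (DM.m<n⇒m/n≡0 (digit<p d)) (DM.m*n/n≡m j p))
    , trans (DM.[m+kn]%n≡m%n r j p) (DM.m<n⇒m%n≡m (digit<p d))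

  digits-divMod : .{{_ : NonZero p}} → ∀ k → Digits k (k DM./ p) (k DM.% p)
  digits-divMod k with j , r , d ← digits-exist (ℕ.>-nonZero⁻¹ p) k
    with digits-/-% d
  ... | refl , refl = d

-- Residues in the prime field, and closed formulas for the counts.

module Counting {q : ℕ} (F : FiniteField q) (p : ℕ) (char : IsCharacteristic F p)
                (x : ℚ) (x-*-p : x * ℕ→ℚ p ≡ ℕ→ℚ q)
                (p⁻¹ : ℚ) (p⁻¹-*-p : p⁻¹ * ℕ→ℚ p ≡ ℚ.1ℚ) where

  open FiniteField F using (0#; 1#; 0≢1) renaming (_+_ to infixl 6 _⊕_; -_ to infix 8 ⊖_)
  open SubsetSums F
  open CommutativeRing ring
    using (+-assoc; +-comm; +-identityˡ; +-identityʳ; -‿inverseˡ; -‿inverseʳ; +-abelianGroup)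
  open AbelianGroupProperties +-abelianGroup using (∙-cancelˡ; ⁻¹-anti-homo‿-)
  open Coefficients x p
  open Digits p

  natF-p : natF F p ≡ 0#
  natF-p = proj₁ (proj₂ char)

  natF-< : ∀ {m} → 0 < m → m < p → natF F m ≢ 0#
  natF-< = proj₂ (proj₂ char) _

  natF-digit : ∀ {k j r} → Digits k j r → natF F k ≡ natF F r
  natF-digit (start _)      = refl
  natF-digit (incr d _)     = cong (1# ⊕_) (natF-digit d)
  natF-digit (carry d refl) = trans (cong (1# ⊕_) (natF-digit d)) natF-p

  -- Otherwise the positive number n - m < p would be 0 in the field.
  natF-distinct : ∀ {m n} → m < n → n < p → natF F m ≢ natF F n
  natF-distinct {m} {n} m<n n<p eq = natF-< (ℕ.m<n⇒0<n∸m m<n) (ℕ.≤-<-trans (ℕ.m∸n≤m n m) n<p)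
    (∙-cancelˡ (natF F m) _ 0# (trans (sym (natF-+ m (n ∸ m)))
      (trans (cong (natF F) (ℕ.m+[n∸m]≡n (ℕ.<⇒≤ m<n))) (trans (sym eq) (sym (+-identityʳ _))))))

  natF-injective : ∀ {m n} → m < p → n < p → natF F m ≡ natF F n → m ≡ n
  natF-injective {m} {n} m<p n<p eq with ℕ.<-cmp m n
  ... | tri< m<n _ _ = contradiction eq (natF-distinct m<n n<p)
  ... | tri≈ _ m≡n _ = m≡n
  ... | tri> _ _ n<m = contradiction (sym eq) (natF-distinct n<m m<p)

  primeRepFrom-below : ∀ c m fuel → below (m ℕ.+ fuel) (primeRepFrom F c m fuel)
  primeRepFrom-below c m zero = _
  primeRepFrom-below c m (suc fuel) with natF F m ≟ᶠ c
  ... | yes _ = ℕ.m<m+n m (s≤s z≤n)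
  ... | no _  = subst (λ n → below n (primeRepFrom F c (suc m) fuel)) (sym (ℕ.+-suc m fuel))
                  (primeRepFrom-below c (suc m) fuel)

  -- The search stops at the first hit, which is the only possible one because the multiples of 1
  -- below `p` are distinct.
  primeRepFrom-natF : ∀ m fuel r → m ≤ r → r < m ℕ.+ fuel → m ℕ.+ fuel ≤ p →
    ∀ c → hasDigit (primeRepFrom F c m fuel) r ≡ ⌊ c ≟ᶠ natF F r ⌋
  primeRepFrom-natF m zero r m≤r r<m _ c =
    contradiction (ℕ.<-≤-trans r<m (ℕ.≤-reflexive (ℕ.+-identityʳ m))) (ℕ.≤⇒≯ m≤r)
  primeRepFrom-natF m (suc fuel) r m≤r r<m+f m+f≤p c with natF F m ≟ᶠ c
  ... | yes refl = ⌊⌋-⇔ (m ℕ.≟ r) (natF F m ≟ᶠ natF F r) (cong (natF F))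
                     (natF-injective (ℕ.<-≤-trans (ℕ.m<m+n m (s≤s z≤n)) m+f≤p) (ℕ.<-≤-trans r<m+f m+f≤p))
  ... | no natFm≢c with m ℕ.≟ r
  ...   | no m≢r   = primeRepFrom-natF (suc m) fuel r (ℕ.≤∧≢⇒< m≤r m≢r)
                       (subst (r <_) (ℕ.+-suc m fuel) r<m+f) (subst (_≤ p) (ℕ.+-suc m fuel) m+f≤p) c
  -- Having passed `m`, the search can only return larger numbers.
  ...   | yes refl = trans (absent (suc m) fuel (ℕ.n<1+n m)) (sym (⌊⌋-false (c ≟ᶠ natF F m) (natFm≢c ∘ sym)))
    where
    absent : ∀ n fuel → m < n → hasDigit (primeRepFrom F c n fuel) m ≡ false
    absent n zero       m<n = refl
    absent n (suc fuel) m<n with natF F n ≟ᶠ c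
    ... | yes _ = ⌊⌋-false (n ℕ.≟ m) (λ n≡m → ℕ.<⇒≢ m<n (sym n≡m))
    ... | no _  = absent (suc n) fuel (ℕ.m<n⇒m<1+n m<n)

  residue : ℕ → Fin q → Maybe ℕ
  residue k b = primeRep F p (natF F k ⊕ ⊖ b)

  -- Lets the induction hypothesis at b - 1 and the claim at b share one residue.
  residue-suc : ∀ k b → residue (suc k) b ≡ residue k (b ⊕ ⊖ 1#)
  residue-suc k b = cong (primeRep F p) (begin
    1# ⊕ natF F k ⊕ ⊖ b       ≡⟨ cong (_⊕ ⊖ b) (+-comm 1# (natF F k)) ⟩
    natF F k ⊕ 1# ⊕ ⊖ b       ≡⟨ +-assoc (natF F k) 1# (⊖ b) ⟩
    natF F k ⊕ (1# ⊕ ⊖ b)     ≡⟨ cong (natF F k ⊕_) (⁻¹-anti-homo‿- b 1#) ⟨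
    natF F k ⊕ ⊖ (b ⊕ ⊖ 1#)   ∎)
    where open ≡-Reasoning

  -- k and r agree in the field, so k - b equals r exactly when b = 0. This matches the jump of `T′`
  -- with the special value of `N₁` at 0.
  residue-digit : ∀ {k j r} → Digits k j r → ∀ b → hasDigit (residue k b) r ≡ ⌊ b ≟ᶠ 0# ⌋
  residue-digit {k} {j} {r} d b = trans
    (primeRepFrom-natF 0 p r z≤n (digit<p d) ℕ.≤-refl (natF F k ⊕ ⊖ b))
    (⌊⌋-⇔ (natF F k ⊕ ⊖ b ≟ᶠ natF F r) (b ≟ᶠ 0#)
      (λ eq → trans (sym (+-identityˡ b)) (trans (cong (_⊕ b) (sym (-b≡0 eq))) (-‿inverseˡ b)))
      (λ { refl → trans (cong (_⊕ ⊖ 0#) (natF-digit d))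
                    (trans (cong (natF F r ⊕_) (trans (sym (+-identityˡ _)) (-‿inverseʳ 0#))) (+-identityʳ _)) }))
    where
    -b≡0 : natF F k ⊕ ⊖ b ≡ natF F r → ⊖ b ≡ 0#
    -b≡0 eq = ∙-cancelˡ (natF F k) (⊖ b) 0# (trans eq (sym (trans (+-identityʳ _) (natF-digit d))))

  Δ : ℕ → ℚ
  Δ k = ℕ→ℚ (N₁ k 0#) - ℕ→ℚ (N₁ k 1#)

  Δ-incr : ∀ k → natF F (suc k) ≢ 0# → Δ (suc k) ≡ ℚ.- Δ k
  Δ-incr k k≢0 = solve-for (ℕ→ℚ (N₁ (suc k) 0#)) (ℕ→ℚ (N₁ (suc k) 1#)) (ℕ→ℚ (N₁ k 0#)) (ℕ→ℚ (N₁ k 1#))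
    (trans (sym (ℕ→ℚ-+ (N₁ (suc k) 1#) (N₁ k 1#)))
      (trans (cong ℕ→ℚ (trans (sym (N₀-suc k 1#)) (trans (N₀-const (suc k) k≢0 1#) (N₀-suc k 0#))))
        (ℕ→ℚ-+ (N₁ (suc k) 0#) (N₁ k 0#))))
    where
    fill : ∀ a b c d → a - b ≡ (a + c) - (b + d) - (c - d)
    fill = solve-∀ ℚ-ring
    drain : ∀ u c d → u - u - (c - d) ≡ ℚ.- (c - d)
    drain = solve-∀ ℚ-ring
    solve-for : ∀ a b c d → b + d ≡ a + c → a - b ≡ ℚ.- (c - d)
    solve-for a b c d eq = trans (fill a b c d) (trans (cong (λ u → (a + c) - u - (c - d)) eq) (drain (a + c) c d))

  -- The difference of the double counts at 0 and 1, kept in multiplied form; `Δ≡` divides by k + 1.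
  Δ-carry : ∀ k → natF F (suc k) ≡ 0# → ℕ→ℚ (suc k) * (Δ (suc k) + Δ k) ≡ ℕ→ℚ q * Δ k
  Δ-carry k k≡0 = trans (regroup (ℕ→ℚ (suc k)) (ℕ→ℚ (N₁ (suc k) 0#)) (ℕ→ℚ (N₁ (suc k) 1#)) (ℕ→ℚ (N₁ k 0#)) (ℕ→ℚ (N₁ k 1#)))
    (trans (cong₂ _-_ (counted 0#) (counted 1#)) (factor (ℕ→ℚ q) (ℕ→ℚ (N₁ k 0#)) (ℕ→ℚ (N₁ k 1#))))
    where
    regroup : ∀ s a b c d → s * ((a - b) + (c - d)) ≡ s * (a + c) - s * (b + d)
    regroup = solve-∀ ℚ-ring
    factor : ∀ s c d → s * c - s * d ≡ s * (c - d)
    factor = solve-∀ ℚ-ring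
    counted : ∀ b → ℕ→ℚ (suc k) * (ℕ→ℚ (N₁ (suc k) b) + ℕ→ℚ (N₁ k b)) ≡ ℕ→ℚ q * ℕ→ℚ (N₁ k b)
    counted b = begin
      ℕ→ℚ (suc k) * (ℕ→ℚ (N₁ (suc k) b) + ℕ→ℚ (N₁ k b))
        ≡⟨ cong (ℕ→ℚ (suc k) *_) (ℕ→ℚ-+ (N₁ (suc k) b) (N₁ k b)) ⟨
      ℕ→ℚ (suc k) * ℕ→ℚ (N₁ (suc k) b ℕ.+ N₁ k b)
        ≡⟨ ℕ→ℚ-* (suc k) (N₁ (suc k) b ℕ.+ N₁ k b) ⟨
      ℕ→ℚ (suc k ℕ.* (N₁ (suc k) b ℕ.+ N₁ k b))
        ≡⟨ cong ℕ→ℚ (trans (cong (suc k ℕ.*_) (sym (N₀-suc k b))) (N₀-count k k≡0 b)) ⟩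
      ℕ→ℚ (q ℕ.* N₁ k b)
        ≡⟨ ℕ→ℚ-* q (N₁ k b) ⟩
      ℕ→ℚ q * ℕ→ℚ (N₁ k b)
        ∎
      where open ≡-Reasoning

  -- A step without carry flips only `sgn k`. At a carry k + 1 = (j + 1) p, so q / (k + 1) - 1 = (x
  -- - 1 - j) / (j + 1), the ratio of consecutive binomials; the signs `sgn k` and `sgn j` flip
  -- together.
  Δ≡ : ∀ {k j r} → Digits k j r → Δ k ≡ sgn k * E j
  Δ≡ (start _) = cong₂ (λ u v → ℕ→ℚ (𝟙 u) - ℕ→ℚ (𝟙 v)) (⌊⌋-true (0# ≟ᶠ 0#) refl) (⌊⌋-false (0# ≟ᶠ 1#) 0≢1)
  Δ≡ {suc k} {j} (incr d r<p) = trans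
    (Δ-incr k (natF-< (s≤s z≤n) r<p ∘ trans (sym (natF-digit (incr d r<p)))))
    (trans (cong ℚ.-_ (Δ≡ d)) (ℚ.neg-distribˡ-* (sgn k) (E j)))
  Δ≡ {suc k} {suc j} d′@(carry d _) = begin
    Δ (suc k)
      -- The two units are about to become (1 / (j + 1)) (j + 1) and p⁻¹ p, which together divide by
      -- k + 1.
      ≡⟨ units (Δ (suc k)) (Δ k) ⟩
    ℚ.1ℚ * ℚ.1ℚ * (Δ (suc k) + Δ k) - Δ k
      ≡⟨ cong₂ (λ u v → u * v * (Δ (suc k) + Δ k) - Δ k) (/-*-cancel 1 (suc j)) p⁻¹-*-p ⟨
    i * ℕ→ℚ (suc j) * (p⁻¹ * ℕ→ℚ p) * (Δ (suc k) + Δ k) - Δ k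
      ≡⟨ regroup₁ i (ℕ→ℚ (suc j)) p⁻¹ (ℕ→ℚ p) (Δ (suc k) + Δ k) (Δ k) ⟩
    i * p⁻¹ * (ℕ→ℚ (suc j) * ℕ→ℚ p * (Δ (suc k) + Δ k)) - Δ k
      ≡⟨ cong (λ u → i * p⁻¹ * (u * (Δ (suc k) + Δ k)) - Δ k)
           (trans (cong ℕ→ℚ (digits-value d′)) (ℕ→ℚ-* (suc j) p)) ⟨
    i * p⁻¹ * (ℕ→ℚ (suc k) * (Δ (suc k) + Δ k)) - Δ k
      ≡⟨ cong (λ u → i * p⁻¹ * u - Δ k) (Δ-carry k (natF-digit d′)) ⟩
    i * p⁻¹ * (ℕ→ℚ q * Δ k) - Δ k
      ≡⟨ cong (λ u → i * p⁻¹ * (u * Δ k) - Δ k) x-*-p ⟨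
    i * p⁻¹ * (x * ℕ→ℚ p * Δ k) - Δ k
      ≡⟨ regroup₂ i p⁻¹ x (ℕ→ℚ p) (Δ k) ⟩
    i * x * (p⁻¹ * ℕ→ℚ p) * Δ k - ℚ.1ℚ * Δ k
      ≡⟨ cong₂ (λ u v → i * x * u * Δ k - v * Δ k) p⁻¹-*-p (sym (1/suc-*-suc j)) ⟩
    i * x * ℚ.1ℚ * Δ k - i * (ℚ.1ℚ + ℕ→ℚ j) * Δ k
      ≡⟨ cong (λ u → i * x * ℚ.1ℚ * u - i * (ℚ.1ℚ + ℕ→ℚ j) * u) (Δ≡ d) ⟩
    i * x * ℚ.1ℚ * (sgn k * E j) - i * (ℚ.1ℚ + ℕ→ℚ j) * (sgn k * E j)
      ≡⟨ regroup₃ i x (sgn k) (sgn j) (binom (x - ℚ.1ℚ) j) (ℕ→ℚ j) ⟩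
    sgn (suc k) * E (suc j)
      ∎
    where
    open ≡-Reasoning
    i = 1/suc j
    units : ∀ a b → a ≡ ℚ.1ℚ * ℚ.1ℚ * (a + b) - b
    units = solve-∀ ℚ-ring
    regroup₁ : ∀ i s c p u v → i * s * (c * p) * u - v ≡ i * c * (s * p * u) - v
    regroup₁ = solve-∀ ℚ-ring
    regroup₂ : ∀ i c x p v → i * c * (x * p * v) - v ≡ i * x * (c * p) * v - ℚ.1ℚ * v
    regroup₂ = solve-∀ ℚ-ring
    regroup₃ : ∀ i x s g b n → i * x * ℚ.1ℚ * (s * (g * b)) - i * (ℚ.1ℚ + n) * (s * (g * b))
                               ≡ (ℚ.- s) * ((ℚ.- g) * (b * ((x - ℚ.1ℚ - n) * i)))
    regroup₃ = solve-∀ ℚ-ring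

  -- Off 0 all values equal N₁(k, 1), so the total binom(q - 1, k) and the difference `Δ k`
  -- determine both values.
  N₁≡ : ∀ k b →
    ℕ→ℚ q * ℕ→ℚ (N₁ k b) ≡ ℕ→ℚ (length F∖0 C k) - Δ k + ℕ→ℚ q * Δ k * 𝟙ℚ ⌊ b ≟ᶠ 0# ⌋
  N₁≡ k b = begin
    ℕ→ℚ q * ℕ→ℚ (N₁ k b)
      ≡⟨ cong₂ _*_ q≡1+ Nkb ⟩
    (ℚ.1ℚ + ℓ) * (n₁ + Δ k * w)
      ≡⟨ regroup ℓ n₀ n₁ w ⟩
    (n₀ + ℓ * n₁) - Δ k + (ℚ.1ℚ + ℓ) * Δ k * w
      ≡⟨ cong₂ (λ u v → u - Δ k + v * Δ k * w) total (sym q≡1+) ⟩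
    ℕ→ℚ (length F∖0 C k) - Δ k + ℕ→ℚ q * Δ k * w
      ∎
    where
    open ≡-Reasoning
    ℓ = ℕ→ℚ (length F∖0)
    n₀ = ℕ→ℚ (N₁ k 0#)
    n₁ = ℕ→ℚ (N₁ k 1#)
    w = 𝟙ℚ ⌊ b ≟ᶠ 0# ⌋
    q≡1+ : ℕ→ℚ q ≡ ℚ.1ℚ + ℓ
    q≡1+ = trans (cong ℕ→ℚ q≡) (ℕ→ℚ-+ 1 (length F∖0))
    total : n₀ + ℓ * n₁ ≡ ℕ→ℚ (length F∖0 C k)
    total = trans (cong (λ u → n₀ + u) (sym (ℕ→ℚ-* (length F∖0) (N₁ k 1#))))
      (trans (sym (ℕ→ℚ-+ (N₁ k 0#) (length F∖0 ℕ.* N₁ k 1#))) (cong ℕ→ℚ (sum-N₁ k)))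
    at-0 : ∀ a b → a ≡ b + (a - b) * ℚ.1ℚ
    at-0 = solve-∀ ℚ-ring
    at-≢0 : ∀ a b → b ≡ b + (a - b) * ℚ.0ℚ
    at-≢0 = solve-∀ ℚ-ring
    Nkb : ℕ→ℚ (N₁ k b) ≡ n₁ + Δ k * w
    Nkb with b ≟ᶠ 0#
    ... | yes b≡0 = trans (cong (ℕ→ℚ ∘ N₁ k) b≡0) (at-0 n₀ n₁)
    ... | no b≢0  = trans (cong ℕ→ℚ (N₁-≢0 k b≢0)) (at-≢0 n₀ n₁)
    regroup : ∀ ℓ n₀ n₁ w → (ℚ.1ℚ + ℓ) * (n₁ + (n₀ - n₁) * w)
                            ≡ (n₀ + ℓ * n₁) - (n₀ - n₁) + (ℚ.1ℚ + ℓ) * (n₀ - n₁) * w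
    regroup = solve-∀ ℚ-ring

  Formula : ℕ → ℕ → ℕ → Fin q → Set
  Formula k j r b = ℕ→ℚ q * ℕ→ℚ (N₂ k b)
    ≡ (ℕ→ℚ (length F∖01 C k) + sgn k * R j r) - ℕ→ℚ q * (sgn k * T′ (residue k b) j r)

  -- Common to both kinds of step: the hypothesis at b - 1 is subtracted from the formula for N₁(k +
  -- 1, b). By Pascal's rule binom(q - 2, k) cancels, and the terms in `E j′` are the increments of
  -- `R` and `T′`.
  formula-suc : ∀ {k j r j′ r′} → Digits k j r → Digits (suc k) j′ r′ →
    R j′ r′ ≡ R j r - E j′ →
    (∀ b → T′ (residue (suc k) b) j′ r′
             ≡ T′ (residue (suc k) b) j r - 𝟙ℚ (hasDigit (residue (suc k) b) r′) * E j′) →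
    (∀ b → Formula k j r b) → ∀ b → Formula (suc k) j′ r′ b
  formula-suc {k} {j} {r} {j′} {r′} d d′ R-step T-step ih b = begin
    Q * ℕ→ℚ (N₂ (suc k) b)
      ≡⟨ add-sub Q (ℕ→ℚ (N₂ (suc k) b)) (ℕ→ℚ (N₂ k (b ⊕ ⊖ 1#))) ⟩
    Q * (ℕ→ℚ (N₂ (suc k) b) + ℕ→ℚ (N₂ k (b ⊕ ⊖ 1#))) - Q * ℕ→ℚ (N₂ k (b ⊕ ⊖ 1#))
      ≡⟨ cong (λ u → Q * u - Q * ℕ→ℚ (N₂ k (b ⊕ ⊖ 1#)))
           (trans (cong ℕ→ℚ (N₁-suc k b)) (ℕ→ℚ-+ (N₂ (suc k) b) (N₂ k (b ⊕ ⊖ 1#)))) ⟨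
    Q * ℕ→ℚ (N₁ (suc k) b) - Q * ℕ→ℚ (N₂ k (b ⊕ ⊖ 1#))
      ≡⟨ cong₂ _-_ first (ih (b ⊕ ⊖ 1#)) ⟩
    ((C₀ + C₁) - (ℚ.- s) * E j′ + Q * ((ℚ.- s) * E j′) * w) - ((C₀ + s * R j r) - Q * (s * T′ (residue k (b ⊕ ⊖ 1#)) j r))
      ≡⟨ cong (λ c → ((C₀ + C₁) - (ℚ.- s) * E j′ + Q * ((ℚ.- s) * E j′) * w) - ((C₀ + s * R j r) - Q * (s * T′ c j r)))
           (sym (residue-suc k b)) ⟩
    ((C₀ + C₁) - (ℚ.- s) * E j′ + Q * ((ℚ.- s) * E j′) * w) - ((C₀ + s * R j r) - Q * (s * t))
      ≡⟨ regroup C₀ C₁ s (E j′) w (R j r) t Q ⟩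
    (C₁ + (ℚ.- s) * (R j r - E j′)) - Q * ((ℚ.- s) * (t - w * E j′))
      ≡⟨ cong₂ (λ u v → (C₁ + (ℚ.- s) * u) - Q * ((ℚ.- s) * v)) (sym R-step)
           (trans (cong (λ u → t - 𝟙ℚ u * E j′) (sym (residue-digit d′ b))) (sym (T-step b))) ⟩
    (C₁ + (ℚ.- s) * R j′ r′) - Q * ((ℚ.- s) * T′ (residue (suc k) b) j′ r′)
      ∎
    where
    open ≡-Reasoning
    Q = ℕ→ℚ q
    s = sgn k
    w = 𝟙ℚ ⌊ b ≟ᶠ 0# ⌋
    t = T′ (residue (suc k) b) j r
    C₀ = ℕ→ℚ (length F∖01 C k)
    C₁ = ℕ→ℚ (length F∖01 C suc k)
    first : Q * ℕ→ℚ (N₁ (suc k) b) ≡ (C₀ + C₁) - (ℚ.- s) * E j′ + Q * ((ℚ.- s) * E j′) * w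
    first = trans (N₁≡ (suc k) b) (cong₂ (λ u v → u - v + Q * v * w)
      (trans (cong ℕ→ℚ (sym (nCk+nC[k+1]≡[n+1]C[k+1] (length F∖01) k))) (ℕ→ℚ-+ (length F∖01 C k) (length F∖01 C suc k)))
      (Δ≡ d′))
    add-sub : ∀ q a b → q * a ≡ q * (a + b) - q * b
    add-sub = solve-∀ ℚ-ring
    regroup : ∀ c c′ s e w r t q →
      ((c + c′) - (ℚ.- s) * e + q * ((ℚ.- s) * e) * w) - ((c + s * r) - q * (s * t))
        ≡ (c′ + (ℚ.- s) * (r - e)) - q * ((ℚ.- s) * (t - w * e))
    regroup = solve-∀ ℚ-ring

  formula : ∀ {k j r} → Digits k j r → ∀ b → Formula k j r b
  formula (incr {k} {j} {r} d r<p) =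
    formula-suc d (incr d r<p) (R-suc j r r<p) (λ b → T-suc (residue (suc k) b) j r) (formula d)
  formula (carry {k} {j} {r} d eq) =
    formula-suc d (carry d eq) (R-carry j r eq)
      (λ b → T-carry (residue (suc k) b) j r eq (primeRepFrom-below (natF F (suc k) ⊕ ⊖ b) 0 p)) (formula d)
  formula (start 0<p) b = begin
    Q * ℕ→ℚ (𝟙 ⌊ 0# ≟ᶠ b ⌋)
      ≡⟨ cong (Q *_) (trans (ℕ→ℚ-𝟙 ⌊ 0# ≟ᶠ b ⌋) (cong 𝟙ℚ (⌊⌋-⇔ (0# ≟ᶠ b) (b ≟ᶠ 0#) sym sym))) ⟩
    Q * 𝟙ℚ ⌊ b ≟ᶠ 0# ⌋
      -- At k = 0 the constant part is 1 - p + (p - 1) = 0, so only the `T′` term, worth q [b = 0],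
      -- is left.
      ≡⟨ regroup Q (𝟙ℚ ⌊ b ≟ᶠ 0# ⌋) (ℕ→ℚ (p ∸ 1)) ⟩
    (ℚ.1ℚ + ℚ.1ℚ * ((ℚ.- ((ℚ.1ℚ + ℕ→ℚ (p ∸ 1)) * (ℚ.1ℚ * ℚ.1ℚ))) + ℕ→ℚ (p ∸ 1) * (ℚ.1ℚ * ℚ.1ℚ)))
      - Q * (ℚ.1ℚ * (ℚ.- 𝟙ℚ ⌊ b ≟ᶠ 0# ⌋))
      ≡⟨ cong₂ (λ u v → (ℚ.1ℚ + ℚ.1ℚ * ((ℚ.- (u * (ℚ.1ℚ * ℚ.1ℚ))) + ℕ→ℚ (p ∸ 1) * (ℚ.1ℚ * ℚ.1ℚ))) - Q * (ℚ.1ℚ * v))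
           (trans (sym (ℕ→ℚ-+ 1 (p ∸ 1))) (cong ℕ→ℚ (ℕ.m+[n∸m]≡n 0<p)))
           (trans (cong (λ u → ℚ.- 𝟙ℚ u) (sym (residue-digit (start 0<p) b))) (sym (T-zero (residue 0 b)))) ⟩
    (ℚ.1ℚ + ℚ.1ℚ * R 0 0) - Q * (ℚ.1ℚ * T′ (residue 0 b) 0 0)
      ≡⟨ cong (λ n → (ℕ→ℚ n + ℚ.1ℚ * R 0 0) - Q * (ℚ.1ℚ * T′ (residue 0 b) 0 0)) (sym (nC0≡1 (length F∖01))) ⟩
    (ℕ→ℚ (length F∖01 C 0) + ℚ.1ℚ * R 0 0) - Q * (ℚ.1ℚ * T′ (residue 0 b) 0 0)
      ∎
    where
    open ≡-Reasoning
    Q = ℕ→ℚ q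
    ℕ→ℚ-𝟙 : ∀ u → ℕ→ℚ (𝟙 u) ≡ 𝟙ℚ u
    ℕ→ℚ-𝟙 true  = refl
    ℕ→ℚ-𝟙 false = refl
    regroup : ∀ q w n → q * w ≡ (ℚ.1ℚ + ℚ.1ℚ * ((ℚ.- ((ℚ.1ℚ + n) * (ℚ.1ℚ * ℚ.1ℚ))) + n * (ℚ.1ℚ * ℚ.1ℚ)))
                                 - q * (ℚ.1ℚ * (ℚ.- w))
    regroup = solve-∀ ℚ-ring

-- Division by q and the conclusion.

÷ℕ-solve : ∀ q n a b s → ℕ→ℚ (suc q) * n ≡ (a + b) - ℕ→ℚ (suc q) * s →
  n ≡ ((a ÷ℕ suc q) + (b ÷ℕ suc q)) - s
÷ℕ-solve q n a b s eq = begin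
  n                              ≡⟨ ℚ.*-identityˡ n ⟨
  ℚ.1ℚ * n                       ≡⟨ cong (_* n) (/-*-cancel 1 (suc q)) ⟨
  i * Q * n                      ≡⟨ ℚ.*-assoc i Q n ⟩
  i * (Q * n)                    ≡⟨ cong (i *_) eq ⟩
  i * ((a + b) - Q * s)          ≡⟨ regroup i a b Q s ⟩
  (a * i + b * i) - i * Q * s    ≡⟨ cong (λ u → (a * i + b * i) - u * s) (/-*-cancel 1 (suc q)) ⟩
  (a * i + b * i) - ℚ.1ℚ * s     ≡⟨ cong (λ u → (a * i + b * i) - u) (ℚ.*-identityˡ s) ⟩
  (a * i + b * i) - s            ∎
  where
  open ≡-Reasoning
  i = 1/suc q
  Q = ℕ→ℚ (suc q)
  regroup : ∀ i a b q s → i * ((a + b) - q * s) ≡ (a * i + b * i) - i * q * s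
  regroup = solve-∀ ℚ-ring

-- `S` computes only once the result of the search is known; then both sides agree by unfolding.
S≡T′ : ∀ {q} (F : FiniteField q) p (pr : Prime p) k c →
  S F p pr k c ≡ Coefficients.T′ (qp q p pr) p (primeRep F p c) (divP p pr k) (modP p pr k)
S≡T′ F p pr k c with primeRep F p c
... | nothing = refl
... | just _  = refl

theorem1p3 : (q : ℕ) (F : FiniteField q) (p : ℕ) (pr : Prime p) →
    IsCharacteristic F p → 2 < q →
    (k : ℕ) → 1 ≤ k → k ≤ q ∸ 2 → (b : Fin q) →
    ℕ→ℚ (N F (noZeroOne F) k b)
    ≡ ((ℕ→ℚ ((q ∸ 2) C k) ÷ℕ q)
    + ((sgn k * R2 q p pr k) ÷ℕ q))
    - (sgn k * S F p pr k (FiniteField._+_ F (natF F k) (FiniteField.-_ F b)))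
theorem1p3 q@(suc q-1) F p pr char 2<q k 1≤k k≤q-2 b =
  ÷ℕ-solve q-1 (ℕ→ℚ (N F (noZeroOne F) k b)) (ℕ→ℚ ((q ∸ 2) C k)) (sgn k * R2 q p pr k)
    (sgn k * S F p pr k c) (begin
    ℕ→ℚ q * ℕ→ℚ (N F (noZeroOne F) k b)
      ≡⟨ cong (λ n → ℕ→ℚ q * ℕ→ℚ n) (SubsetSums.N≡cnt F (noZeroOne F) k b) ⟩
    ℕ→ℚ q * ℕ→ℚ (SubsetSums.N₂ F k b)
      -- `R2` unfolds to `R` at the quotient and remainder of `k`, while `S` is restored in the next
      -- step.
      ≡⟨ formula (Digits.digits-divMod p k) b ⟩
    (ℕ→ℚ (length (SubsetSums.F∖01 F) C k) + sgn k * R2 q p pr k) - ℕ→ℚ q * (sgn k * T′ (primeRep F p c) (divP p pr k) (modP p pr k))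
      ≡⟨ cong₂ (λ n s → (ℕ→ℚ (n C k) + sgn k * R2 q p pr k) - ℕ→ℚ q * (sgn k * s))
           (cong (_∸ 2) (sym (SubsetSums.q≡ F))) (sym (S≡T′ F p pr k c)) ⟩
    (ℕ→ℚ ((q ∸ 2) C k) + sgn k * R2 q p pr k) - ℕ→ℚ q * (sgn k * S F p pr k c)
      ∎)
  where
  open ≡-Reasoning
  c = FiniteField._+_ F (natF F k) (FiniteField.-_ F b)
  instance
    p≢0 : NonZero p
    p≢0 = prime⇒nonZero pr
  open Counting F p char (qp q p pr) (/-*-cancel q p) ((+ 1) ℚ./ p) (/-*-cancel 1 p)
  open Coefficients (qp q p pr) p using (T′)
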